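{- Let $\Sigma=\{1,\square,h,s,t\}$ and let $Z$ be the string rewriting system over $\Sigma$ with the seven rules $h11\to 1h$, $11h\square \to 11s\square$, $1s\to s1$, $\square s\to \square h$, $h1\square \to t11\square$, $1t\to t111$, $\square t\to\square h$. There is no dimension $d\geq 1$ and no family of affine maps $[\sigma](x)=M_\sigma x+v_\sigma$ ($\sigma\in\Sigma$, $M_\sigma\in\mathbb{N}^{d\times d}$, $v_\sigma\in\mathbb{N}^d$) such that every $[\sigma]$ is strictly monotone with respect to $>$ (i.e. $x>y$ implies $[\sigma](x)>[\sigma](y)$), for at least one rule $\ell\to r$ of $Z$ we have $[\ell](x)>[r](x)$ for all $x\in\mathbb{N}^d$, and for every remaining rule $\ell'\to r'$ of $Z$ we have $[\ell'](x)\gtrsim[r'](x)$ for all $x\in\mathbb{N}^d$.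
   Context: Strings are finite words over $\Sigma$; the interpretation is extended to strings by $[s_1 s_2\cdots s_n]=[s_1]\circ[s_2]\circ\cdots\circ[s_n]$ (the empty string being the identity). On $\mathbb{N}^d$: $x>y$ iff $x_1>y_1$ and $x_i\geq y_i$ for all $i\in\{2,\dots,d\}$; $x\gtrsim y$ iff $x_i\geq y_i$ for all $i$. -}

module Defs where

open import Data.List.Base using (List; []; _∷_)
open import Data.Nat.Base using (ℕ; suc; _+_; _*_; _≥_; _>_)
open import Data.Nat.Properties using (+-*-semiring)
open import Algebra.Properties.Semiring.Sum +-*-semiring using (sum)
open import Data.Product.Base using (_×_)
open import Data.Vec.Functional using (Vector; head; tail)
open import Data.Vec.Functional.Relation.Binary.Pointwise using (Pointwise)
open import Function.Base using (id; _∘_)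

infix 4 _≻_ _≳_ _⟶_

data Symbol : Set where
  𝟏 □ h s t : Symbol

Word : Set
Word = List Symbol

record Rule : Set where
  constructor _⟶_
  field
    lhs : Word
    rhs : Word

Z : List Rule
Z = (h ∷ 𝟏 ∷ 𝟏 ∷ []     ⟶ 𝟏 ∷ h ∷ [])
  ∷ (𝟏 ∷ 𝟏 ∷ h ∷ □ ∷ [] ⟶ 𝟏 ∷ 𝟏 ∷ s ∷ □ ∷ [])
  ∷ (𝟏 ∷ s ∷ []         ⟶ s ∷ 𝟏 ∷ [])
  ∷ (□ ∷ s ∷ []         ⟶ □ ∷ h ∷ [])
  ∷ (h ∷ 𝟏 ∷ □ ∷ []     ⟶ t ∷ 𝟏 ∷ 𝟏 ∷ □ ∷ [])
  ∷ (𝟏 ∷ t ∷ []         ⟶ t ∷ 𝟏 ∷ 𝟏 ∷ 𝟏 ∷ [])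
  ∷ (□ ∷ t ∷ []         ⟶ □ ∷ h ∷ [])
  ∷ []

-- The distinguished first coordinate of the order requires dimension at least
-- one, hence the index suc n.
_≻_ : ∀ {n} → Vector ℕ (suc n) → Vector ℕ (suc n) → Set
x ≻ y = head x > head y × Pointwise _≥_ (tail x) (tail y)

_≳_ : ∀ {d} → Vector ℕ d → Vector ℕ d → Set
x ≳ y = Pointwise _≥_ x y

-- M i is the i-th row of the matrix M.
record AffineMap (d : ℕ) : Set where
  field
    M : Vector (Vector ℕ d) d
    v : Vector ℕ d

  apply : Vector ℕ d → Vector ℕ d
  apply x i = sum (λ j → M i j * x j) + v i

open AffineMap public using (apply)

StrictlyMonotone : ∀ {n} → (Vector ℕ (suc n) → Vector ℕ (suc n)) → Set
StrictlyMonotone f = ∀ x y → x ≻ y → f x ≻ f y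

Interpretation : ℕ → Set
Interpretation d = Symbol → AffineMap d

⟦_⟧ : ∀ {d} → Word → Interpretation d → Vector ℕ d → Vector ℕ d
⟦ []    ⟧ I = id
⟦ σ ∷ w ⟧ I = apply (I σ) ∘ ⟦ w ⟧ I

StrictlyOriented : ∀ {n} → Interpretation (suc n) → Rule → Set
StrictlyOriented I (l ⟶ r) = ∀ x → ⟦ l ⟧ I x ≻ ⟦ r ⟧ I x

WeaklyOriented : ∀ {d} → Interpretation d → Rule → Set
WeaklyOriented I (l ⟶ r) = ∀ x → ⟦ l ⟧ I x ≳ ⟦ r ⟧ I x

{-# OPTIONS --safe #-}

-- Let f n be the first coordinate of the value of □ h 1ⁿ □ at 0.  Rewriting
-- simulates the Collatz map, so f n ≤ f (2n) and f (3n + 2) ≤ f (2n + 1), and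
-- one of the two inequalities is always strict.  By Dickson's lemma the orbit
-- 1ⁿ □ 0 contains two comparable members, so by monotonicity f n ≤ f (n + p)
-- for some p ≥ 1 and all large n.  Writing g m = f (m - 1), the second
-- inequality reads g (3m) ≤ g (2m); hence i ↦ g (ip) is eventually both
-- nondecreasing and nonincreasing, so constant, which rules out strictness of
-- the second inequality.  Trading factors 2 of p for factors 3, g is bounded on
-- large multiples of some odd number E.  But among these multiples there are
-- 1 + 2ᵏn with k arbitrarily large, and g (1 + 2ᵏn) = f (2ᵏn) ≥ k if the first
-- inequality is strict.
module Submission where

open import Defs
open import Data.List.Membership.Propositional using (_∈_)
open import Data.Nat.Base using (ℕ; suc)
open import Data.Product.Base using (Σ-syntax; ∃-syntax; _×_)
open import Relation.Binary.PropositionalEquality using (_≢_)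
open import Relation.Nullary using (¬_)

open import Algebra.Properties.Semiring.Sum using (sum)
open import Data.Empty using (⊥)
open import Data.Fin.Base using (zero; suc)
open import Data.List.Base using ([]; _∷_)
open import Data.List.Relation.Unary.Any using (here; there)
open import Data.Nat.Base
open import Data.Nat.GeneralisedArithmetic using (fold; fold-+)
open import Data.Nat.Induction using (<-wellFounded)
open import Data.Nat.Properties
open import Data.Nat.Tactic.RingSolver using (solve-∀)
open import Data.Product.Base using (∃; ∃₂; _,_; proj₁; proj₂)
open import Data.Sum.Base using (_⊎_; inj₁; inj₂; [_,_]′)
open import Data.Unit.Base using (⊤; tt)
open import Data.Vec.Functional using (Vector; head; tail)
open import Function.Base using (id; _∘_)
open import Induction.WellFounded using (module All; Acc; acc)
import Relation.Binary.Construct.On as On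
open import Relation.Binary.PropositionalEquality
  using (_≡_; refl; sym; trans; cong; subst; subst₂; module ≡-Reasoning)
open import Relation.Nullary using (contradiction)
open import Relation.Nullary.Decidable using (decidable-stable)
open import Level using (0ℓ)

-- Dickson's lemma

-- If no minimum existed, well-founded induction on the value of `f` would refute every element of
-- `A`.
¬¬-minimum : ∀ {A : Set} (f : A → ℕ) → A → ¬ ¬ (∃ λ m → ∀ j → f m ≤ f j)
¬¬-minimum f a ∄min = wfRec (λ _ → ⊥) step a
  where
  open All (On.wellFounded f <-wellFounded) 0ℓ

  step : ∀ m → (∀ {j} → f j < f m → ⊥) → ⊥
  step m ih = ∄min (m , λ j → ≮⇒≥ (ih {j}))

Infinite : (ℕ → Set) → Set
Infinite Q = ∀ n → ¬ ¬ (∃ λ m → n ≤ m × Q m)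

-- The classical proof passes to a subsequence nondecreasing in the head; here
-- the subsequence is the predicate Q′, which avoids choice under ¬¬.
¬¬-dickson : ∀ {d} (a : ℕ → Vector ℕ d) (Q : ℕ → Set) → Infinite Q →
             ¬ ¬ (∃₂ λ i j → i < j × Q i × Q j × a j ≳ a i)
¬¬-dickson {zero} a Q inf k =
  inf 0 λ (i , _ , qi) → inf (suc i) λ (j , i<j , qj) →
  k (i , j , i<j , qi , qj , λ ())
¬¬-dickson {suc d} a Q inf k =
  ¬¬-dickson (tail ∘ a) Q′ inf′ λ (i , j , i<j , (qi , min) , (qj , _) , aj≳ai) →
  k (i , j , i<j , qi , qj , λ { zero → min j i<j qj ; (suc l) → aj≳ai l })
  where
  Q′ : ℕ → Set
  Q′ i = Q i × (∀ j → i < j → Q j → head (a i) ≤ head (a j))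

  inf′ : Infinite Q′
  inf′ n k = inf n λ x →
    -- Among the members from `n` on, one with the least head lies below all its successors, as `Q′`
    -- demands.
    ¬¬-minimum {∃ λ m → n ≤ m × Q m} (head ∘ a ∘ proj₁) x
      λ ((m , n≤m , qm) , min) →
    k (m , n≤m , qm , λ j m<j qj → min (j , ≤-trans n≤m (<⇒≤ m<j) , qj))

-- Functions descending along Collatz steps

even-or-odd : ∀ n → ∃ λ k → n ≡ k * 2 ⊎ n ≡ 1 + k * 2
even-or-odd zero    = 0 , inj₁ refl
even-or-odd (suc n) with even-or-odd n
... | k , inj₁ refl = k , inj₂ refl
... | k , inj₂ refl = suc k , inj₁ refl

-- Newton iteration y ↦ y (E y) inverts the odd number E modulo powers of 2.
odd-invertible : ∀ e k → ∃₂ λ y q → (1 + e * 2) * y ≡ 1 + 2 ^ suc k * q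
odd-invertible e zero    = 1 , e , eq e
  where
  eq : ∀ e → (1 + e * 2) * 1 ≡ 1 + 2 * e
  eq = solve-∀
odd-invertible e (suc k) with odd-invertible e k
... | y , q , eq = y * ((1 + e * 2) * y) , q + 2 ^ k * (q * q) , (begin
  (1 + e * 2) * (y * ((1 + e * 2) * y))               ≡⟨ *-assoc (1 + e * 2) y _ ⟨
  (1 + e * 2) * y * ((1 + e * 2) * y)                 ≡⟨ cong (λ z → z * z) eq ⟩
  (1 + 2 * 2 ^ k * q) * (1 + 2 * 2 ^ k * q)           ≡⟨ square (2 ^ k) q ⟩
  1 + 2 * (2 * 2 ^ k) * (q + 2 ^ k * (q * q))         ∎)
  where
  open ≡-Reasoning
  square : ∀ m q → (1 + 2 * m * q) * (1 + 2 * m * q) ≡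
                   1 + 2 * (2 * m) * (q + m * (q * q))
  square = solve-∀

module CollatzDescent
  (f : ℕ → ℕ) (p N : ℕ) .{{_ : NonZero p}}
  (odd-step : ∀ n → 1 ≤ n → f (n * 3 + 2) ≤ f (n * 2 + 1))
  (periodic : ∀ n → N ≤ n → f n ≤ f (p + n))
  where

  g F : ℕ → ℕ
  g m = f (pred m)
  F i = g (i * p)

  -- The relation is abstract so as to serve both as `_≤_` and, in `odd-not-strict`, as `_<_`.
  module _ (_∼_ : ℕ → ℕ → Set)
           (step : ∀ n → 1 ≤ n → f (n * 3 + 2) ∼ f (n * 2 + 1)) where

    g-step : ∀ m → 2 ≤ m → g (m * 3) ∼ g (m * 2)
    g-step (suc n) (s≤s 1≤n) = subst₂ (λ a b → f a ∼ f b)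
      (+-comm (n * 3) 2) (+-comm (n * 2) 1) (step n 1≤n)

    F-step : ∀ j → 2 ≤ j → F (j * 3) ∼ F (j * 2)
    F-step j 2≤j = subst₂ (λ a b → g a ∼ g b) (swap j p 3) (swap j p 2)
      (g-step (j * p) (≤-trans 2≤j (m≤m*n j p)))
      where
      swap : ∀ a b c → a * b * c ≡ a * c * b
      swap = solve-∀

  g-periodic : ∀ m → N < m → g m ≤ g (p + m)
  g-periodic (suc k) (s≤s N≤k) =
    subst (λ a → f k ≤ f (pred a)) (sym (+-suc p k)) (periodic k N≤k)

  -- Raising the index of `F` by one raises the argument of `g` by one period `p`.
  F-mono+ : ∀ i → N < i → ∀ k → F i ≤ F (k + i)
  F-mono+ i N<i zero    = ≤-refl
  F-mono+ i N<i (suc k) = ≤-trans (F-mono+ i N<i k)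
    (g-periodic _ (≤-trans (m≤n⇒m≤o+n k N<i) (m≤m*n (k + i) p)))

  F-mono : ∀ {i j} → N < i → i ≤ j → F i ≤ F j
  F-mono {i} {j} N<i i≤j =
    subst (λ a → F i ≤ F a) (m∸n+n≡m i≤j) (F-mono+ i N<i (j ∸ i))

  odd-not-strict : ¬ (∀ n → 1 ≤ n → f (n * 3 + 2) < f (n * 2 + 1))
  odd-not-strict strict = <⇒≱ (F-step _<_ strict j (m≤m+n 2 N))
    (F-mono (≤-trans (s≤s (m≤n+m N 1)) (m≤m*n j 2)) (*-monoʳ-≤ j (n≤1+n 2)))
    where
    j : ℕ
    j = 2 + N

  -- Large enough that `B ≤ i` gives `3 + N ≤ j * 2` for `j` the half of `i` rounded down; hence
  -- `2 ≤ j` and `N < j * 2`.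
  B : ℕ
  B = 4 + N

  -- A sandwich: `suc i` lies below `j * 3` and `i` above `j * 2`, and the odd step leads down from
  -- `F (j * 3)` to `F (j * 2)`.
  F-descends : ∀ j i → 3 + N ≤ j * 2 → j * 2 ≤ i → i ≤ 1 + j * 2 → F (suc i) ≤ F i
  F-descends j i 3+N≤2j 2j≤i i≤1+2j = begin
    F (suc i)  ≤⟨ F-mono (m≤n⇒m≤1+n (≤-trans N<2j 2j≤i)) 1+i≤3j ⟩
    F (j * 3)  ≤⟨ F-step _≤_ odd-step j 2≤j ⟩
    F (j * 2)  ≤⟨ F-mono N<2j 2j≤i ⟩
    F i        ∎
    where
    open ≤-Reasoning

    N<2j : N < j * 2
    N<2j = ≤-trans (m≤n+m (suc N) 2) 3+N≤2j

    2≤j : 2 ≤ j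
    2≤j = *-cancelʳ-< 2 1 j (≤-trans (m≤m+n 3 N) 3+N≤2j)

    1+i≤3j : suc i ≤ j * 3
    1+i≤3j = begin
      suc i      ≤⟨ s≤s i≤1+2j ⟩
      2 + j * 2  ≤⟨ +-monoˡ-≤ (j * 2) 2≤j ⟩
      j + j * 2  ≡⟨ *-suc j 2 ⟨
      j * 3      ∎

  F-antitone : ∀ i → B ≤ i → F (suc i) ≤ F i
  F-antitone i B≤i with even-or-odd i
  ... | j , inj₁ refl = F-descends j _ (<⇒≤ B≤i) ≤-refl (n≤1+n _)
  ... | j , inj₂ refl = F-descends j _ (s≤s⁻¹ B≤i) (n≤1+n _) ≤-refl

  F-bounded : ∀ x → B ≤ x → F x ≤ F B
  F-bounded x B≤x = subst (λ a → F a ≤ F B) (m∸n+n≡m B≤x) (go (x ∸ B))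
    where
    go : ∀ k → F (k + B) ≤ F B
    go zero    = ≤-refl
    go (suc k) = ≤-trans (F-antitone (k + B) (m≤n+m B k)) (go k)

  Bounded : ℕ → Set
  Bounded D = ∀ x → B ≤ x → g (D * x) ≤ F B

  -- While `D` is even, `g-step` carries the bound from `2m` to `3m`. This halves `D` and triples
  -- the odd factor: `3 (1 + 2e) = 1 + 2 (1 + 3e)`.
  bounded-at-odd : ∀ D e .{{_ : NonZero D}} → Bounded (D * (1 + e * 2)) →
                   ∃ λ e′ → Bounded (1 + e′ * 2)
  bounded-at-odd D = go D (<-wellFounded D)
    where
    go : ∀ D → Acc _<_ D → ∀ e .{{_ : NonZero D}} → Bounded (D * (1 + e * 2)) →
         ∃ λ e′ → Bounded (1 + e′ * 2)
    go D (acc rs) e bnd with even-or-odd D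
    ... | k , inj₂ refl = k + e + k * e * 2 , subst Bounded (eq k e) bnd
      where
      eq : ∀ k e → (1 + k * 2) * (1 + e * 2) ≡ 1 + (k + e + k * e * 2) * 2
      eq = solve-∀
    ... | k@(suc _) , inj₁ refl = go k (rs (m<m*n k 2 (s≤s (s≤s z≤n)))) (1 + e * 3)
      λ x B≤x → ≤-trans
        (subst₂ (λ a b → g a ≤ g b) (eq₃ k e x) (eq₂ k e x)
          (g-step _≤_ odd-step (k * (1 + e * 2) * x)
            (≤-trans (≤-trans (s≤s (s≤s z≤n)) B≤x)
              (m≤n*m x (k * (1 + e * 2)) {{m*n≢0 k (1 + e * 2)}}))))
        (bnd x B≤x)
      where
      eq₂ : ∀ k e x → k * (1 + e * 2) * x * 2 ≡ k * 2 * (1 + e * 2) * x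
      eq₂ = solve-∀
      eq₃ : ∀ k e x → k * (1 + e * 2) * x * 3 ≡ k * (1 + (1 + e * 3) * 2) * x
      eq₃ = solve-∀

  even-not-strict : ¬ (∀ n → 2 ≤ n → f n < f (n * 2))
  even-not-strict strict =
    let e , bnd = bounded-at-odd p 0 (subst (λ a → Bounded a) (sym (*-identityʳ p))
                    λ x B≤x → subst (λ a → g a ≤ F B) (*-comm x p) (F-bounded x B≤x))
    in unbounded e bnd
    where
    powers : ∀ k n → 2 ≤ n → k ≤ f (2 ^ k * n)
    powers zero    n 2≤n = z≤n
    powers (suc k) n 2≤n = subst (λ a → suc k ≤ f a) (eq (2 ^ k) n)
      (≤-<-trans (powers k n 2≤n)
        (strict (2 ^ k * n) (≤-trans 2≤n (m≤n*m n (2 ^ k) {{m^n≢0 2 k}}))))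
      where
      eq : ∀ m n → m * n * 2 ≡ 2 * m * n
      eq = solve-∀

    unbounded : ∀ e → ¬ Bounded (1 + e * 2)
    unbounded e bnd with odd-invertible e (F B)
    ... | zero , q , eq = contradiction (trans (sym eq) (*-zeroʳ (1 + e * 2))) λ ()
    ... | y@(suc _) , q , eq =
      <⇒≱ (powers K n 2≤n) (subst (λ a → g a ≤ F B) Ex≡1+2ᴷn (bnd x B≤x))
      where
      K M n x : ℕ
      K = suc (F B)
      M = 2 ^ K
      n = q + M * q * B + B
      -- The factor `1 + M * B` is 1 modulo `M`, so `x` inverts the odd number just as `y` does,
      -- while `x` reaches `B` and `n` reaches 2.
      x = y * (1 + M * B)

      2≤n : 2 ≤ n
      2≤n = ≤-trans (s≤s (s≤s z≤n)) (m≤n+m B (q + M * q * B))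

      B≤x : B ≤ x
      B≤x = begin
        B              ≤⟨ m≤n*m B M {{m^n≢0 2 K}} ⟩
        M * B          ≤⟨ n≤1+n _ ⟩
        1 + M * B      ≤⟨ m≤n*m (1 + M * B) y ⟩
        y * (1 + M * B) ∎
        where open ≤-Reasoning

      Ex≡1+2ᴷn : (1 + e * 2) * x ≡ 1 + M * n
      Ex≡1+2ᴷn = begin
        (1 + e * 2) * (y * (1 + M * B)) ≡⟨ *-assoc (1 + e * 2) y _ ⟨
        (1 + e * 2) * y * (1 + M * B)   ≡⟨ cong (_* (1 + M * B)) eq ⟩
        (1 + M * q) * (1 + M * B)       ≡⟨ expand M q B ⟩
        1 + M * n                       ∎
        where
        open ≡-Reasoning
        expand : ∀ M q B → (1 + M * q) * (1 + M * B) ≡ 1 + M * (q + M * q * B + B)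
        expand = solve-∀

-- Simulation of Collatz steps by rewriting

sum-mono : ∀ {d} {x y : Vector ℕ d} → x ≳ y → sum +-*-semiring y ≤ sum +-*-semiring x
sum-mono {zero}  x≳y = z≤n
sum-mono {suc d} x≳y = +-mono-≤ (x≳y zero) (sum-mono (x≳y ∘ suc))

apply-mono : ∀ {d} (A : AffineMap d) {x y} → x ≳ y → apply A x ≳ apply A y
apply-mono A x≳y i =
  +-monoˡ-≤ (v i) (sum-mono λ j → *-monoʳ-≤ (M i j) (x≳y j))
  where open AffineMap A

≻⇒≳ : ∀ {n} {x y : Vector ℕ (suc n)} → x ≻ y → x ≳ y
≻⇒≳ (x₁>y₁ , _)  zero    = <⇒≤ x₁>y₁
≻⇒≳ (_ , xᵢ≥yᵢ) (suc i) = xᵢ≥yᵢ i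

module Simulation
  {d : ℕ} (I : Interpretation (suc d))
  (mono : ∀ σ → StrictlyMonotone (apply (I σ)))
  (ρ : Rule) (ρ∈Z : ρ ∈ Z) (oriented : StrictlyOriented I ρ)
  (others : ∀ ρ′ → ρ′ ∈ Z → ρ′ ≢ ρ → WeaklyOriented I ρ′)
  where

  State : Set
  State = Vector ℕ (suc d)

  infix 4 _⊒[_]_

  -- P stands for the use of the strictly oriented rule on the way from x to y.
  record _⊒[_]_ (x : State) (P : Set) (y : State) : Set where
    constructor _,_
    field
      weakly   : x ≳ y
      strictly : P → head y < head x

  open _⊒[_]_

  -- `split` locates the strict use in one of the halves; the weak descent of the other half
  -- preserves the drop.
  ⊒-trans : ∀ {P Q R x y z} → (R → P ⊎ Q) → x ⊒[ P ] y → y ⊒[ Q ] z → x ⊒[ R ] z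
  ⊒-trans split (x≳y , x>y) (y≳z , y>z) =
    (λ i → ≤-trans (y≳z i) (x≳y i)) ,
    [ (λ p → ≤-<-trans (y≳z zero) (x>y p))
    , (λ q → <-≤-trans (y>z q) (x≳y zero)) ]′ ∘ split

  ⊒-cong : ∀ {P} σ {x y} → x ⊒[ P ] y → apply (I σ) x ⊒[ P ] apply (I σ) y
  ⊒-cong σ {x} {y} (x≳y , x>y) =
    apply-mono (I σ) x≳y , λ p → proj₁ (mono σ x y (x>y p , x≳y ∘ suc))

  rule : ∀ {ρ′} → ρ′ ∈ Z → ∀ x →
         ⟦ Rule.lhs ρ′ ⟧ I x ⊒[ ρ ≡ ρ′ ] ⟦ Rule.rhs ρ′ ⟧ I x
  rule {ρ′} ρ′∈Z x = weak , λ { refl → proj₁ (oriented x) }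
    where
    strict⇒weak : ρ′ ≡ ρ → WeaklyOriented I ρ′
    strict⇒weak refl x = ≻⇒≳ {x = ⟦ Rule.lhs ρ ⟧ I x} {⟦ Rule.rhs ρ ⟧ I x} (oriented x)

    weak : ⟦ Rule.lhs ρ′ ⟧ I x ≳ ⟦ Rule.rhs ρ′ ⟧ I x
    -- Stability of `_≤_` on numbers replaces an equality test on rules: if the inequality failed,
    -- `strict⇒weak` would give `ρ′ ≢ ρ`, and then `others` applies.
    weak i = decidable-stable (_ ≤? _) λ ≰ →
      ≰ (others ρ′ ρ′∈Z (λ ρ′≡ρ → ≰ (strict⇒weak ρ′≡ρ x i)) x i)

  ⟨_⟩ : Symbol → State → State
  ⟨ σ ⟩ = apply (I σ)

  𝟏^ : ℕ → State → State
  𝟏^ n x = fold x ⟨ 𝟏 ⟩ n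

  𝟏^-+ : ∀ m n x → 𝟏^ (m + n) x ≡ 𝟏^ m (𝟏^ n x)
  𝟏^-+ m n x = fold-+ x ⟨ 𝟏 ⟩ m

  𝟏^-cong : ∀ {P} n {x y} → x ⊒[ P ] y → 𝟏^ n x ⊒[ P ] 𝟏^ n y
  𝟏^-cong zero    x⊒y = x⊒y
  𝟏^-cong (suc n) x⊒y = ⊒-cong 𝟏 (𝟏^-cong n x⊒y)

  -- `h` moves right through the block and halves it. `1 ≤ n` ensures a use of the rule, and the
  -- first use already yields strictness.
  h-pass : ∀ {P} → (∀ x → ⟨ h ⟩ (𝟏^ 2 x) ⊒[ P ] ⟨ 𝟏 ⟩ (⟨ h ⟩ x)) →
           ∀ n → 1 ≤ n → ∀ x → ⟨ h ⟩ (𝟏^ (n * 2) x) ⊒[ P ] 𝟏^ n (⟨ h ⟩ x)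
  h-pass r (suc zero)      _ x = r x
  h-pass r (suc n@(suc _)) _ x =
    ⊒-trans inj₁ (r (𝟏^ (n * 2) x)) (⊒-cong 𝟏 (h-pass r n (s≤s z≤n) x))

  -- `σ` moves left, each `𝟏` that it crosses becoming `k` of them: one for `s`, three for `t`.
  𝟏-pass : ∀ {P} σ k → (∀ x → ⟨ 𝟏 ⟩ (⟨ σ ⟩ x) ⊒[ P ] ⟨ σ ⟩ (𝟏^ k x)) →
           ∀ n → 1 ≤ n → ∀ x → 𝟏^ n (⟨ σ ⟩ x) ⊒[ P ] ⟨ σ ⟩ (𝟏^ (n * k) x)
  𝟏-pass {P} σ k r (suc zero) _ x =
    subst (λ m → ⟨ 𝟏 ⟩ (⟨ σ ⟩ x) ⊒[ P ] ⟨ σ ⟩ (𝟏^ m x)) (sym (+-identityʳ k)) (r x)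
  𝟏-pass {P} σ k r (suc n@(suc _)) _ x =
    ⊒-trans inj₁ (⊒-cong 𝟏 (𝟏-pass σ k r n (s≤s z≤n) x))
      (subst (λ y → ⟨ 𝟏 ⟩ (⟨ σ ⟩ (𝟏^ (n * k) x)) ⊒[ P ] ⟨ σ ⟩ y)
        (sym (𝟏^-+ k (n * k) x)) (r (𝟏^ (n * k) x)))

  z : State
  z = ⟨ □ ⟩ (λ _ → 0)

  Φ : ℕ → State
  Φ n = ⟨ □ ⟩ (⟨ h ⟩ (𝟏^ n z))

  Z₁ Z₂ Z₃ Z₄ Z₅ Z₆ Z₇ : Rule
  Z₁ = h ∷ 𝟏 ∷ 𝟏 ∷ []     ⟶ 𝟏 ∷ h ∷ []
  Z₂ = 𝟏 ∷ 𝟏 ∷ h ∷ □ ∷ [] ⟶ 𝟏 ∷ 𝟏 ∷ s ∷ □ ∷ []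
  Z₃ = 𝟏 ∷ s ∷ []         ⟶ s ∷ 𝟏 ∷ []
  Z₄ = □ ∷ s ∷ []         ⟶ □ ∷ h ∷ []
  Z₅ = h ∷ 𝟏 ∷ □ ∷ []     ⟶ t ∷ 𝟏 ∷ 𝟏 ∷ □ ∷ []
  Z₆ = 𝟏 ∷ t ∷ []         ⟶ t ∷ 𝟏 ∷ 𝟏 ∷ 𝟏 ∷ []
  Z₇ = □ ∷ t ∷ []         ⟶ □ ∷ h ∷ []

  -- Nested like the calls of `⊒-trans` in `even-step` and `odd-step`, so that `id` serves as
  -- `split`.
  EvenRule OddRule : Set
  EvenRule = (ρ ≡ Z₁ ⊎ ρ ≡ Z₂) ⊎ (ρ ≡ Z₃ ⊎ ρ ≡ Z₄)
  OddRule  = (ρ ≡ Z₁ ⊎ ρ ≡ Z₅) ⊎ (ρ ≡ Z₆ ⊎ ρ ≡ Z₇)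

  even-or-odd-rule : ρ ∈ Z → EvenRule ⊎ OddRule
  even-or-odd-rule (here eq)                                                 = inj₁ (inj₁ (inj₁ eq))
  even-or-odd-rule (there (here eq))                                         = inj₁ (inj₁ (inj₂ eq))
  even-or-odd-rule (there (there (here eq)))                                 = inj₁ (inj₂ (inj₁ eq))
  even-or-odd-rule (there (there (there (here eq))))                         = inj₁ (inj₂ (inj₂ eq))
  even-or-odd-rule (there (there (there (there (here eq)))))                 = inj₂ (inj₁ (inj₂ eq))
  even-or-odd-rule (there (there (there (there (there (here eq))))))         = inj₂ (inj₂ (inj₁ eq))
  even-or-odd-rule (there (there (there (there (there (there (here eq))))))) = inj₂ (inj₂ (inj₂ eq))

  rule₁ = rule {Z₁} (here refl)
  rule₂ = rule {Z₂} (there (here refl))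
  rule₃ = rule {Z₃} (there (there (here refl)))
  rule₄ = rule {Z₄} (there (there (there (here refl))))
  rule₅ = rule {Z₅} (there (there (there (there (here refl)))))
  rule₆ = rule {Z₆} (there (there (there (there (there (here refl))))))
  rule₇ = rule {Z₇} (there (there (there (there (there (there (here refl)))))))

  -- `Z₂` consumes two symbols `𝟏` before `h`; the remaining `n ∸ 2` are context.
  h→s : ∀ n → 2 ≤ n → 𝟏^ n (⟨ h ⟩ z) ⊒[ ρ ≡ Z₂ ] 𝟏^ n (⟨ s ⟩ z)
  h→s n 2≤n = subst₂ _⊒[ ρ ≡ Z₂ ]_ (eq _) (eq _)
    (𝟏^-cong (n ∸ 2) (rule₂ (λ _ → 0)))
    where
    eq : ∀ x → 𝟏^ (n ∸ 2) (𝟏^ 2 x) ≡ 𝟏^ n x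
    eq x = trans (sym (𝟏^-+ (n ∸ 2) 2 x)) (cong (λ m → 𝟏^ m x) (m∸n+n≡m 2≤n))

  -- The derivation is `□h1²ⁿ□ → □1ⁿh□ → □1ⁿs□ → □s1ⁿ□ → □h1ⁿ□`.
  even-step : ∀ n → 2 ≤ n → Φ (n * 2) ⊒[ EvenRule ] Φ n
  even-step n 2≤n = ⊒-trans id
    (⊒-trans id (⊒-cong □ (h-pass rule₁ n 1≤n z)) (⊒-cong □ (h→s n 2≤n)))
    (⊒-trans id
      (⊒-cong □ (𝟏-pass s 1 rule₃ n 1≤n z))
      (subst (λ m → ⟨ □ ⟩ (⟨ s ⟩ (𝟏^ (n * 1) z)) ⊒[ ρ ≡ Z₄ ] Φ m) (*-identityʳ n)
        (rule₄ (𝟏^ (n * 1) z))))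
    where
    1≤n : 1 ≤ n
    1≤n = <⇒≤ 2≤n

  -- The derivation is `□h1²ⁿ⁺¹□ → □1ⁿh1□ → □1ⁿt11□ → □t1³ⁿ⁺²□ → □h1³ⁿ⁺²□`.
  odd-step : ∀ n → 1 ≤ n → Φ (n * 2 + 1) ⊒[ OddRule ] Φ (n * 3 + 2)
  odd-step n 1≤n = subst₂ _⊒[ OddRule ]_
    (cong (⟨ □ ⟩ ∘ ⟨ h ⟩) (sym (𝟏^-+ (n * 2) 1 z)))
    (cong (⟨ □ ⟩ ∘ ⟨ h ⟩) (sym (𝟏^-+ (n * 3) 2 z)))
    (⊒-trans id
      (⊒-trans id (⊒-cong □ (h-pass rule₁ n 1≤n (𝟏^ 1 z)))
        (⊒-cong □ (𝟏^-cong n (rule₅ (λ _ → 0)))))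
      (⊒-trans id
        (⊒-cong □ (𝟏-pass t 3 rule₆ n 1≤n (𝟏^ 2 z)))
        (rule₇ (𝟏^ (n * 3) (𝟏^ 2 z)))))

  contradictory : ⊥
  contradictory = ¬¬-dickson (λ n → 𝟏^ n z) (λ _ → ⊤) (λ n k → k (n , ≤-refl , tt))
    λ (i , j , i<j , _ , _ , 𝟏ʲz≳𝟏ⁱz) → impossible i j i<j 𝟏ʲz≳𝟏ⁱz
    where
    impossible : ∀ i j → i < j → 𝟏^ j z ≳ 𝟏^ i z → ⊥
    impossible i j i<j 𝟏ʲz≳𝟏ⁱz =
      [ (λ even → even-not-strict λ n 2≤n → strictly (even-step n 2≤n) even)
      , (λ odd → odd-not-strict λ n 1≤n → strictly (odd-step n 1≤n) odd)
      ]′ (even-or-odd-rule ρ∈Z)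
      where
      p : ℕ
      p = j ∸ i

      𝟏^-periodic : ∀ n → i ≤ n → 𝟏^ (p + n) z ≳ 𝟏^ n z
      𝟏^-periodic n i≤n = subst₂ _≳_
        (trans (sym (𝟏^-+ (n ∸ i) j z)) (cong (λ m → 𝟏^ m z) eq))
        (trans (sym (𝟏^-+ (n ∸ i) i z)) (cong (λ m → 𝟏^ m z) (m∸n+n≡m i≤n)))
        -- Dickson's lemma gives only a weak comparison; `⊥` makes the strict part vacuous.
        (weakly (𝟏^-cong {⊥} (n ∸ i) (𝟏ʲz≳𝟏ⁱz , λ ())))
        where
        open ≡-Reasoning
        eq : n ∸ i + j ≡ p + n
        eq = begin
          n ∸ i + j          ≡⟨ cong (n ∸ i +_) (m∸n+n≡m (<⇒≤ i<j)) ⟨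
          n ∸ i + (p + i)    ≡⟨ +-comm (n ∸ i) (p + i) ⟩
          p + i + (n ∸ i)    ≡⟨ +-assoc p i _ ⟩
          p + (i + (n ∸ i))  ≡⟨ cong (p +_) (m+[n∸m]≡n i≤n) ⟩
          p + n              ∎

      open CollatzDescent (head ∘ Φ) p i {{>-nonZero (m<n⇒0<n∸m i<j)}}
        (λ n 1≤n → weakly (odd-step n 1≤n) zero)
        (λ n i≤n → apply-mono (I □) (apply-mono (I h) (𝟏^-periodic n i≤n)) zero)

mainTheorem2 : ∀ (n : ℕ) →
    ¬ (Σ[ I ∈ Interpretation (suc n) ]
    (∀ σ → StrictlyMonotone (apply (I σ))) ×
    (∃[ ρ ] ρ ∈ Z × StrictlyOriented I ρ ×
    (∀ ρ′ → ρ′ ∈ Z → ρ′ ≢ ρ → WeaklyOriented I ρ′)))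
mainTheorem2 n (I , mono , ρ , ρ∈Z , oriented , others) =
  Simulation.contradictory I mono ρ ρ∈Z oriented others
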